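{- The $\mathbf{ab}$-index is multiplicative with respect to the Stanley product of quasi-graded posets: for two quasi-graded posets $P$ and $Q$, each having a minimal and a (different) maximal element, $$\Psi(P*Q)=\Psi(P)\cdot\Psi(Q).$$
   Context: A quasi-graded poset $(P,\rho,\bar\zeta)$ consists of a finite poset $P$, a function $\rho:P\to\mathbb N$ with $x<y\Rightarrow\rho(x)<\rho(y)$, and a complex-valued function $\bar\zeta$ in the incidence algebra of $P$ with $\bar\zeta(x,x)=1$ for all $x$. Write $\rho(x,y)=\rho(y)-\rho(x)$. If $P$ has minimal element $\hat0$ and maximal element $\hat1$ with $\hat0<\hat1$, normalize $\rho(\hat0)=0$; its $\mathbf{ab}$-index is the polynomial in non-commuting variables $\mathbf a,\mathbf b$ $$\Psi(P)=\sum_{c}\bar\zeta(x_0,x_1)\cdots\bar\zeta(x_{k-1},x_k)\cdot(\mathbf a-\mathbf b)^{\rho(x_0,x_1)-1}\,\mathbf b\,(\mathbf a-\mathbf b)^{\rho(x_1,x_2)-1}\,\mathbf b\cdots\mathbf b\,(\mathbf a-\mathbf b)^{\rho(x_{k-1},x_k)-1},$$ the sum over all chains $c=\{\hat0=x_0<x_1<\cdots<x_k=\hat1\}$, $k\ge1$. The Stanley product $P*Q$ of $(P,\rho_P,\bar\zeta_P)$ and $(Q,\rho_Q,\bar\zeta_Q)$ is the quasi-graded poset with underlying set the disjoint union $(P\setminus\{\hat1\})\cup(Q\setminus\{\hat0\})$; $x\le y$ iff (i) $x,y\in P\setminus\{\hat1\}$ and $x\le_Py$, or (ii) $x\in P\setminus\{\hat1\}$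 and $y\in Q\setminus\{\hat0\}$, or (iii) $x,y\in Q\setminus\{\hat0\}$ and $x\le_Qy$; $\rho(x)=\rho_P(x)$ for $x\in P\setminus\{\hat1\}$ and $\rho(x)=\rho_Q(x)+\rho_P(\hat0,\hat1)-1$ for $x\in Q\setminus\{\hat0\}$; $\bar\zeta(x,y)=\bar\zeta_P(x,y)$ in case (i), $\bar\zeta(x,y)=\bar\zeta_P(x,\hat1)\cdot\bar\zeta_Q(\hat0,y)$ in case (ii), $\bar\zeta(x,y)=\bar\zeta_Q(x,y)$ in case (iii). -}

module Defs where

open import Algebra.Bundles using (CommutativeRing; RawRing)
import Algebra.Definitions.RawSemiring as RawSemiringDefs
open import Data.Bool.Base using (if_then_else_)
open import Data.Irrelevant using () renaming ([_] to irr)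
open import Data.List.Base
  using (List; []; _∷_; _++_; map; foldr; filter; concatMap; cartesianProductWith)
import Data.List.Membership.Propositional as Mem
open import Data.List.Membership.Propositional.Properties
  using (∈-++⁺ˡ; ∈-++⁺ʳ; ∈-map⁺; ∈-map⁻; ∈-filter⁺; ∈-concatMap⁺; ∈-concatMap⁻)
import Data.List.Properties as List
open import Data.List.Relation.Unary.All as All using ([])
open import Data.List.Relation.Unary.AllPairs using ([]; _∷_)
open import Data.List.Relation.Unary.Any using (here)
open import Data.List.Relation.Unary.Unique.Propositional using (Unique)
import Data.List.Relation.Unary.Unique.Propositional.Properties as Unique
open import Data.Nat.Base as ℕ using (ℕ; zero; suc; _∸_)
import Data.Nat.Properties as ℕ
open import Data.Product.Base using (_×_; _,_; proj₁; proj₂; map₁)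
open import Data.Refinement using (Refinement-syntax; _,_; value; value-injective)
  renaming (_≟_ to refinement-≟)
open import Data.Sum.Base using (_⊎_; inj₁; inj₂)
open import Data.Sum.Properties using (inj₁-injective; inj₂-injective)
  renaming (≡-dec to ⊎-≡-dec)
open import Data.Sum.Relation.Binary.LeftOrder
  using (_⊎-<_; ₁∼₂; ₁∼₁; ₂∼₂; drop-inj₁; drop-inj₂; ⊎-<-transitive; ⊎-<-decidable)
open import Function.Base using (_∘_)
open import Level using (Level; _⊔_) renaming (suc to lsuc)
open import Relation.Binary.Core using (Rel)
open import Relation.Binary.Definitions
  using (Decidable; DecidableEquality; Minimum; Maximum; Antisymmetric)
open import Relation.Binary.PropositionalEquality
  using (_≡_; _≢_; refl; sym; cong; subst; isEquivalence)
open import Relation.Binary.Structures using (IsDecPartialOrder)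
import Relation.Binary.Construct.NonStrictToStrict as NonStrictToStrict
open import Relation.Nullary using (¬_; yes; no; does)
open import Relation.Nullary.Decidable using (¬?; recompute)
open import Relation.Nullary.Negation using (contradiction)
open import Relation.Unary using (Pred) renaming (Decidable to Decidable₁)

data Letter : Set where
  𝐚 𝐛 : Letter

Word : Set
Word = List Letter

_≟ˡ_ : DecidableEquality Letter
𝐚 ≟ˡ 𝐚 = yes refl
𝐚 ≟ˡ 𝐛 = no λ ()
𝐛 ≟ˡ 𝐚 = no λ ()
𝐛 ≟ˡ 𝐛 = yes refl

_≟ʷ_ : DecidableEquality Word
_≟ʷ_ = List.≡-dec _≟ˡ_

-- The free associative algebra K⟨𝐚,𝐛⟩.  A polynomial is a finite formal
-- K-linear combination of words; repeated words and zero coefficients are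
-- allowed in the representation, and _≈_ compares total coefficients.
module NoncommutativePolynomial {c ℓ} (K : CommutativeRing c ℓ) where

  private module K = CommutativeRing K

  infix  4 _≈_
  infixl 6 _+_
  infixl 7 _*_ _·_
  infix  8 -_

  Polynomial : Set c
  Polynomial = List (K.Carrier × Word)

  coefficient : Polynomial → Word → K.Carrier
  coefficient []            w = K.0#
  coefficient ((k , v) ∷ p) w =
    if does (v ≟ʷ w) then k K.+ coefficient p w else coefficient p w

  _≈_ : Rel Polynomial ℓ
  p ≈ q = ∀ w → coefficient p w K.≈ coefficient q w

  0ₚ 1ₚ a b : Polynomial
  0ₚ = []
  1ₚ = (K.1# , []) ∷ []
  a  = (K.1# , 𝐚 ∷ []) ∷ []
  b  = (K.1# , 𝐛 ∷ []) ∷ []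

  _+_ _*_ : Polynomial → Polynomial → Polynomial
  p + q = p ++ q
  p * q = cartesianProductWith (λ (k , u) (l , v) → (k K.* l , u ++ v)) p q

  _·_ : K.Carrier → Polynomial → Polynomial
  k · p = map (map₁ (k K.*_)) p

  -_ : Polynomial → Polynomial
  - p = map (map₁ (λ k → K.- k)) p

  sum : List Polynomial → Polynomial
  sum = foldr _+_ 0ₚ

  rawRing : RawRing c ℓ
  rawRing = record
    { Carrier = Polynomial ; _≈_ = _≈_ ; _+_ = _+_ ; _*_ = _*_ ; -_ = -_ ; 0# = 0ₚ ; 1# = 1ₚ }

  open RawSemiringDefs (RawRing.rawSemiring rawRing) public using (_^_)

module _ {a p} {A : Set a} {P : Pred A p} (P? : Decidable₁ P) where

  open Mem using (_∈_)

  restrict : List A → List [ x ∈ A ∣ P x ]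
  restrict []       = []
  restrict (x ∷ xs) with P? x
  ... | yes px = (x , irr px) ∷ restrict xs
  ... | no  _  = restrict xs

  map-value-restrict : ∀ xs → map value (restrict xs) ≡ filter P? xs
  map-value-restrict []       = refl
  map-value-restrict (x ∷ xs) with P? x
  ... | yes _ = cong (x ∷_) (map-value-restrict xs)
  ... | no  _ = map-value-restrict xs

  restrict-complete : ∀ {xs} (x : [ x ∈ A ∣ P x ]) → value x ∈ xs → x ∈ restrict xs
  restrict-complete {xs} (x , irr px) x∈xs =
    let x∈        = subst (x ∈_) (sym (map-value-restrict xs))
                      (∈-filter⁺ P? x∈xs (recompute (P? x) px))
        y , y∈ , e = ∈-map⁻ value x∈
    in subst (_∈ restrict xs) (sym (value-injective e)) y∈

  restrict-unique : ∀ {xs} → Unique xs → Unique (restrict xs)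
  restrict-unique {xs} u =
    Unique.map⁻ (subst Unique (sym (map-value-restrict xs)) (Unique.filter⁺ P? u))

-- Coefficients lie in an arbitrary commutative ring K; classically K = ℂ.
module QuasiGraded {c ℓ} (K : CommutativeRing c ℓ) where

  private module K = CommutativeRing K

  open NoncommutativePolynomial K public

  record QuasiGradedPoset (p r : Level) : Set (c ⊔ ℓ ⊔ lsuc (p ⊔ r)) where
    infix 4 _≤_
    field
      Carrier           : Set p
      _≤_               : Rel Carrier r
      isDecPartialOrder : IsDecPartialOrder _≡_ _≤_

    open IsDecPartialOrder isDecPartialOrder public
      using (_≟_; _≤?_; antisym)
      renaming (refl to ≤-refl; trans to ≤-trans; isPartialOrder to ≤-isPartialOrder)
    open NonStrictToStrict _≡_ _≤_ public using (_<_)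
    open Mem using (_∈_)

    -- ζ is an element of the incidence algebra: a function on the intervals
    -- [x , y].  The irrelevant argument makes it depend on x and y only.
    field
      elements          : List Carrier
      elements-complete : ∀ x → x ∈ elements
      elements-unique   : Unique elements
      ρ                 : Carrier → ℕ
      ρ-strictMono      : ∀ {x y} → x < y → ρ x ℕ.< ρ y
      ζ                 : ∀ x y → .(x ≤ y) → K.Carrier
      ζ-diagonal        : ∀ x → ζ x x ≤-refl K.≈ K.1#

    _<?_ : Decidable _<_
    _<?_ = NonStrictToStrict.<-decidable _≡_ _≤_ _≟_ _≤?_

    ρ[_,_] : Carrier → Carrier → ℕ
    ρ[ x , y ] = ρ y ∸ ρ x

    -- Chains x = x₀ < x₁ < ⋯ < xₖ = y with k ≥ 1.
    data Chain : Carrier → Carrier → Set (p ⊔ r) where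
      [_] : ∀ {x y} → .(x < y) → Chain x y
      _∷_ : ∀ {x z y} → .(x < z) → Chain z y → Chain x y

    singleStep : ∀ x y → List (Chain x y)
    singleStep x y with x <? y
    ... | yes x<y = [ x<y ] ∷ []
    ... | no  _   = []

    prepend : ∀ {y} x z → List (Chain z y) → List (Chain x y)
    prepend x z cs with x <? z
    ... | yes x<z = map (x<z ∷_) cs
    ... | no  _   = []

    -- All chains from x to y with at most n steps.
    chainsUpTo : ℕ → ∀ x y → List (Chain x y)
    chainsUpTo zero    x y = []
    chainsUpTo (suc n) x y =
      singleStep x y ++ concatMap (λ z → prepend x z (chainsUpTo n z y)) elements

    -- Since ρ is strictly increasing, a chain has at most ρ[ x , y ] steps, so
    -- this lists every chain exactly once (chains-complete, chains-unique).
    chains : ∀ x y → List (Chain x y)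
    chains x y = chainsUpTo ρ[ x , y ] x y

    ζ-product : ∀ {x y} → Chain x y → K.Carrier
    ζ-product ([_] {x} {y} x<y)   = ζ x y (proj₁ x<y)
    ζ-product (_∷_ {x} {z} x<z γ) = ζ x z (proj₁ x<z) K.* ζ-product γ

    -- The exponents ρ[ x , z ] ∸ 1 are not truncated, as x < z.
    chainPolynomial : ∀ {x y} → Chain x y → Polynomial
    chainPolynomial ([_] {x} {y} _)   = (a + - b) ^ (ρ[ x , y ] ∸ 1)
    chainPolynomial (_∷_ {x} {z} _ γ) = (a + - b) ^ (ρ[ x , z ] ∸ 1) * b * chainPolynomial γ

    ρ< : ∀ {x y} → .(x < y) → ρ x ℕ.< ρ y
    ρ< {x} {y} x<y = recompute (ρ x ℕ.<? ρ y) (ρ-strictMono x<y)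

    chain⇒ρ< : ∀ {x y} → Chain x y → ρ x ℕ.< ρ y
    chain⇒ρ< [ x<y ]   = ρ< x<y
    chain⇒ρ< (x<z ∷ γ) = ℕ.<-trans (ρ< x<z) (chain⇒ρ< γ)

    ∈-singleStep : ∀ {x y} .(x<y : x < y) → [ x<y ] ∈ singleStep x y
    ∈-singleStep {x} {y} x<y with x <? y
    ... | yes _   = here refl
    ... | no  x≮y = contradiction (recompute (x <? y) x<y) x≮y

    ∈-prepend : ∀ {x z y} .(x<z : x < z) {γ : Chain z y} {cs} → γ ∈ cs →
                (x<z ∷ γ) ∈ prepend x z cs
    ∈-prepend {x} {z} x<z γ∈ with x <? z
    ... | yes x<z′ = ∈-map⁺ (Chain._∷_ x<z′) γ∈
    ... | no  x≮z  = contradiction (recompute (x <? z) x<z) x≮z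

    chainsUpTo-complete : ∀ n {x y} (γ : Chain x y) → ρ y ℕ.≤ n ℕ.+ ρ x → γ ∈ chainsUpTo n x y
    chainsUpTo-complete zero    γ h = contradiction h (ℕ.<⇒≱ (chain⇒ρ< γ))
    chainsUpTo-complete (suc n) [ x<y ] h = ∈-++⁺ˡ (∈-singleStep x<y)
    chainsUpTo-complete (suc n) {x} {y} (_∷_ {z = z} x<z γ) h =
      ∈-++⁺ʳ (singleStep x y)
        (∈-concatMap⁺ (λ z → prepend x z (chainsUpTo n z y))
          (Mem.lose (elements-complete z)
            (∈-prepend x<z (chainsUpTo-complete n γ bound))))
      where
      bound : ρ y ℕ.≤ n ℕ.+ ρ z
      bound = ℕ.≤-trans h (subst (ℕ._≤ n ℕ.+ ρ z) (ℕ.+-suc n (ρ x)) (ℕ.+-monoʳ-≤ n (ρ< x<z)))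

    data StartsVia {x y} (z : Carrier) : Chain x y → Set (p ⊔ r) where
      via : .{x<z : x < z} {γ : Chain z y} → StartsVia z (x<z ∷ γ)

    ∈-prepend⁻ : ∀ {x z y} cs {γ : Chain x y} → γ ∈ prepend x z cs → StartsVia z γ
    ∈-prepend⁻ {x} {z} cs γ∈ with x <? z
    ∈-prepend⁻ {x} {z} cs γ∈ | yes x<z with _ , _ , refl ← ∈-map⁻ (Chain._∷_ x<z) γ∈ = via

    via-unique : ∀ {x y z z′} {γ : Chain x y} → StartsVia z γ → StartsVia z′ γ → z ≡ z′
    via-unique via via = refl

    ∷-injective : ∀ {x z y} .{x<z : x < z} {γ δ : Chain z y} →
                  _≡_ {A = Chain x y} (x<z ∷ γ) (x<z ∷ δ) → γ ≡ δ
    ∷-injective refl = refl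

    prepend-unique : ∀ {x z y} {cs : List (Chain z y)} → Unique cs → Unique (prepend x z cs)
    prepend-unique {x} {z} u with x <? z
    ... | yes x<z = Unique.map⁺ (∷-injective {x<z = x<z}) u
    ... | no  _   = []

    singleStep-unique : ∀ x y → Unique (singleStep x y)
    singleStep-unique x y with x <? y
    ... | yes _ = [] ∷ []
    ... | no  _ = []

    ∈-singleStep⁻ : ∀ {x y z} {γ : Chain x y} → γ ∈ singleStep x y → ¬ StartsVia z γ
    ∈-singleStep⁻ {x} {y} γ∈ v with x <? y
    ∈-singleStep⁻ (here refl) () | yes _

    chainsUpTo-unique : ∀ n x y → Unique (chainsUpTo n x y)
    longer-unique : ∀ n x y {zs} → Unique zs →
                    Unique (concatMap (λ z → prepend x z (chainsUpTo n z y)) zs)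

    chainsUpTo-unique zero    x y = []
    chainsUpTo-unique (suc n) x y =
      Unique.++⁺ (singleStep-unique x y) (longer-unique n x y elements-unique)
        λ (γ∈₁ , γ∈₂) →
          let z , _ , γ∈ = Mem.find (∈-concatMap⁻ (λ z → prepend x z (chainsUpTo n z y)) {xs = elements} γ∈₂)
          in ∈-singleStep⁻ γ∈₁ (∈-prepend⁻ (chainsUpTo n z y) γ∈)

    longer-unique n x y [] = []
    longer-unique n x y {z ∷ zs} (z∉zs ∷ u) =
      Unique.++⁺ (prepend-unique (chainsUpTo-unique n z y)) (longer-unique n x y u)
        λ (γ∈₁ , γ∈₂) →
          let z′ , z′∈ , γ∈ = Mem.find (∈-concatMap⁻ (λ z → prepend x z (chainsUpTo n z y)) {xs = zs} γ∈₂)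
          in All.lookup z∉zs z′∈
               (via-unique (∈-prepend⁻ (chainsUpTo n z y) γ∈₁) (∈-prepend⁻ (chainsUpTo n z′ y) γ∈))

    chains-complete : ∀ {x y} (γ : Chain x y) → γ ∈ chains x y
    chains-complete {x} {y} γ = chainsUpTo-complete ρ[ x , y ] γ
      (ℕ.≤-reflexive (sym (ℕ.m∸n+n≡m (ℕ.<⇒≤ (chain⇒ρ< γ)))))

    chains-unique : ∀ x y → Unique (chains x y)
    chains-unique x y = chainsUpTo-unique ρ[ x , y ] x y

  record BoundedQuasiGradedPoset (p r : Level) : Set (c ⊔ ℓ ⊔ lsuc (p ⊔ r)) where
    field
      quasiGradedPoset : QuasiGradedPoset p r

    open QuasiGradedPoset quasiGradedPoset public

    field
      0̂ 1̂     : Carrier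
      minimum : Minimum _≤_ 0̂
      maximum : Maximum _≤_ 1̂
      0̂<1̂     : 0̂ < 1̂
      ρ-0̂     : ρ 0̂ ≡ 0

  Ψ : ∀ {p r} → BoundedQuasiGradedPoset p r → Polynomial
  Ψ P = sum (map (λ γ → ζ-product γ · chainPolynomial γ) (chains 0̂ 1̂))
    where open BoundedQuasiGradedPoset P

  module StanleyProduct {p₁ r₁ p₂ r₂}
    (P : BoundedQuasiGradedPoset p₁ r₁) (Q : BoundedQuasiGradedPoset p₂ r₂) where

    private
      module P = BoundedQuasiGradedPoset P
      module Q = BoundedQuasiGradedPoset Q

    open Mem using (_∈_)

    P∖1̂ : Set p₁
    P∖1̂ = [ x ∈ P.Carrier ∣ x ≢ P.1̂ ]

    Q∖0̂ : Set p₂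
    Q∖0̂ = [ y ∈ Q.Carrier ∣ y ≢ Q.0̂ ]

    Carrier : Set (p₁ ⊔ p₂)
    Carrier = P∖1̂ ⊎ Q∖0̂

    _≤₁_ : Rel P∖1̂ r₁
    x ≤₁ y = value x P.≤ value y

    _≤₂_ : Rel Q∖0̂ r₂
    x ≤₂ y = value x Q.≤ value y

    _≤_ : Rel Carrier (p₁ ⊔ p₂ ⊔ r₁ ⊔ r₂)
    _≤_ = _≤₁_ ⊎-< _≤₂_

    open NonStrictToStrict _≡_ _≤_ using (_<_)

    ρ : Carrier → ℕ
    ρ (inj₁ x) = P.ρ (value x)
    ρ (inj₂ y) = Q.ρ (value y) ℕ.+ P.ρ[ P.0̂ , P.1̂ ] ∸ 1

    ζ : ∀ x y → .(x ≤ y) → K.Carrier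
    ζ (inj₁ x) (inj₁ y) x≤y = P.ζ (value x) (value y) (drop-inj₁ x≤y)
    ζ (inj₁ x) (inj₂ y) _   = P.ζ (value x) P.1̂ (P.maximum (value x))
                                K.* Q.ζ Q.0̂ (value y) (Q.minimum (value y))
    ζ (inj₂ x) (inj₂ y) x≤y = Q.ζ (value x) (value y) (drop-inj₂ x≤y)

    ≤-reflexive : ∀ {x y} → x ≡ y → x ≤ y
    ≤-reflexive {inj₁ _} refl = ₁∼₁ P.≤-refl
    ≤-reflexive {inj₂ _} refl = ₂∼₂ Q.≤-refl

    ≤-antisym : Antisymmetric _≡_ _≤_
    ≤-antisym (₁∼₁ h) (₁∼₁ k) = cong inj₁ (value-injective (P.antisym h k))
    ≤-antisym (₂∼₂ h) (₂∼₂ k) = cong inj₂ (value-injective (Q.antisym h k))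

    isDecPartialOrder : IsDecPartialOrder _≡_ _≤_
    isDecPartialOrder = record
      { isPartialOrder = record
        { isPreorder = record
          { isEquivalence = isEquivalence
          ; reflexive     = ≤-reflexive
          ; trans         = ⊎-<-transitive P.≤-trans Q.≤-trans
          }
        ; antisym = ≤-antisym
        }
      ; _≟_  = ⊎-≡-dec (refinement-≟ P._≟_) (refinement-≟ Q._≟_)
      ; _≤?_ = ⊎-<-decidable (λ x y → value x P.≤? value y) (λ x y → value x Q.≤? value y)
      }

    ≢1̂? : Decidable₁ (_≢ P.1̂)
    ≢1̂? x = ¬? (x P.≟ P.1̂)

    ≢0̂? : Decidable₁ (_≢ Q.0̂)
    ≢0̂? y = ¬? (y Q.≟ Q.0̂)

    elements : List Carrier
    elements = map inj₁ (restrict ≢1̂? P.elements) ++ map inj₂ (restrict ≢0̂? Q.elements)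

    elements-complete : ∀ x → x ∈ elements
    elements-complete (inj₁ x) =
      ∈-++⁺ˡ (∈-map⁺ inj₁ (restrict-complete ≢1̂? x (P.elements-complete (value x))))
    elements-complete (inj₂ y) =
      ∈-++⁺ʳ (map inj₁ (restrict ≢1̂? P.elements))
        (∈-map⁺ inj₂ (restrict-complete ≢0̂? y (Q.elements-complete (value y))))

    elements-unique : Unique elements
    elements-unique = Unique.++⁺
      (Unique.map⁺ inj₁-injective (restrict-unique ≢1̂? P.elements-unique))
      (Unique.map⁺ inj₂-injective (restrict-unique ≢0̂? Q.elements-unique))
      disjoint
      where
      disjoint : ∀ {v} → ¬ (v ∈ map inj₁ _ × v ∈ map inj₂ _)
      disjoint (v∈₁ , v∈₂) with _ , _ , refl ← ∈-map⁻ inj₁ v∈₁ | _ , _ , () ← ∈-map⁻ inj₂ v∈₂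

    ρ₁<ρ1̂ : ∀ (x : P∖1̂) → P.ρ (value x) ℕ.< P.ρ P.1̂
    ρ₁<ρ1̂ (x , irr x≢1̂) = P.ρ-strictMono (P.maximum x , recompute (≢1̂? x) x≢1̂)

    0<ρ₂ : ∀ (y : Q∖0̂) → 0 ℕ.< Q.ρ (value y)
    0<ρ₂ (y , irr y≢0̂) = ℕ.≤-<-trans ℕ.z≤n
      (Q.ρ-strictMono (Q.minimum y , λ 0̂≡y → recompute (≢0̂? y) y≢0̂ (sym 0̂≡y)))

    ρ[0̂,1̂] : P.ρ[ P.0̂ , P.1̂ ] ≡ P.ρ P.1̂
    ρ[0̂,1̂] = cong (P.ρ P.1̂ ∸_) P.ρ-0̂

    ρ-strictMono : ∀ {x y} → x < y → ρ x ℕ.< ρ y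
    ρ-strictMono (₁∼₁ x≤y , x≢y) = P.ρ-strictMono (x≤y , x≢y ∘ cong inj₁ ∘ value-injective)
    ρ-strictMono {inj₁ x} {inj₂ y} (₁∼₂ , _) rewrite ρ[0̂,1̂] with Q.ρ (value y) | 0<ρ₂ y
    ... | suc n | _ = ℕ.<-≤-trans (ρ₁<ρ1̂ x) (ℕ.m≤n+m (P.ρ P.1̂) n)
    ρ-strictMono {inj₂ x} {inj₂ y} (₂∼₂ x≤y , x≢y) = ℕ.∸-monoˡ-<
      (ℕ.+-monoˡ-< P.ρ[ P.0̂ , P.1̂ ] (Q.ρ-strictMono (x≤y , x≢y ∘ cong inj₂ ∘ value-injective)))
      (ℕ.≤-trans (0<ρ₂ x) (ℕ.m≤m+n _ _))

    ζ-diagonal : ∀ x → ζ x x (≤-reflexive refl) K.≈ K.1#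
    ζ-diagonal (inj₁ x) = P.ζ-diagonal (value x)
    ζ-diagonal (inj₂ y) = Q.ζ-diagonal (value y)

    0̂ 1̂ : Carrier
    0̂ = inj₁ (P.0̂ , irr (proj₂ P.0̂<1̂))
    1̂ = inj₂ (Q.1̂ , irr (proj₂ Q.0̂<1̂ ∘ sym))

    minimum : Minimum _≤_ 0̂
    minimum (inj₁ x) = ₁∼₁ (P.minimum (value x))
    minimum (inj₂ y) = ₁∼₂

    maximum : Maximum _≤_ 1̂
    maximum (inj₁ x) = ₁∼₂
    maximum (inj₂ y) = ₂∼₂ (Q.maximum (value y))

  infixl 7 _⋆_

  _⋆_ : ∀ {p₁ r₁ p₂ r₂} → BoundedQuasiGradedPoset p₁ r₁ → BoundedQuasiGradedPoset p₂ r₂ →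
        BoundedQuasiGradedPoset (p₁ ⊔ p₂) (p₁ ⊔ p₂ ⊔ r₁ ⊔ r₂)
  P ⋆ Q = record
    { quasiGradedPoset = record
      { Carrier           = S.Carrier
      ; _≤_               = S._≤_
      ; isDecPartialOrder = S.isDecPartialOrder
      ; elements          = S.elements
      ; elements-complete = S.elements-complete
      ; elements-unique   = S.elements-unique
      ; ρ                 = S.ρ
      ; ρ-strictMono      = S.ρ-strictMono
      ; ζ                 = S.ζ
      ; ζ-diagonal        = S.ζ-diagonal
      }
    ; 0̂       = S.0̂
    ; 1̂       = S.1̂
    ; minimum = S.minimum
    ; maximum = S.maximum
    ; 0̂<1̂     = ₁∼₂ , λ ()
    ; ρ-0̂     = BoundedQuasiGradedPoset.ρ-0̂ P
    }
    where module S = StanleyProduct P Q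

{-# OPTIONS --safe #-}
module Submission where

-- Let Ψ(x) be the sum of the weights of the chains from x to 1̂, and let
-- e(x , z) = ζ̄(x , z) (𝐚 - 𝐛)^(ρ(x , z) - 1) if x < z and 0 otherwise.
-- Splitting off the first step of a chain gives
--   Ψ(x) = e(x , 1̂) + Σ_z e(x , z) 𝐛 Ψ(z).
-- In P * Q the grading and ζ̄ are such that e(x , y) = e(x , 1̂) e(0̂ , y) for x
-- in P and y in Q.  Hence by induction downwards from 1̂, Ψ_{P*Q}(y) = Ψ_Q(y) for
-- y in Q, and for x in P the steps from x into Q contribute e(x , 1̂) Ψ_Q(0̂),
-- so that Ψ_{P*Q}(x) = Ψ_P(x) Ψ_Q(0̂).

open import Defs
open import Algebra.Bundles using (CommutativeRing; Semiring)
import Algebra.Properties.CommutativeSemigroup as CommutativeSemigroupProperties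
import Algebra.Properties.Semiring.Exp as Exp
open import Data.Bool.Base using (true; false; if_then_else_)
open import Data.Irrelevant using () renaming ([_] to irr)
open import Data.List.Base using (List; []; _∷_; _++_; map; foldr; concatMap)
open import Data.List.Properties using (++-assoc; ++-identityʳ; map-∘; concatMap-cong)
open import Data.Nat.Base as ℕ using (ℕ; zero; suc; _∸_)
import Data.Nat.Properties as ℕ
open import Data.Product.Base using (_,_; proj₁; proj₂; map₂)
open import Data.Refinement using (Refinement; _,_; value; value-injective)
open import Data.Sum.Base using (_⊎_; inj₁; inj₂)
open import Data.Sum.Properties using (inj₁-injective; inj₂-injective)
open import Data.Sum.Relation.Binary.LeftOrder using (₁∼₂; ₁∼₁; ₂∼₂; drop-inj₁; drop-inj₂)
open import Level using (Level)
open import Relation.Binary.PropositionalEquality as ≡ using (_≡_; _≢_)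
import Relation.Binary.Reasoning.Setoid as SetoidReasoning
open import Relation.Nullary using (¬_; yes; no; does)
open import Relation.Nullary.Decidable using (decidable-stable)
open import Relation.Nullary.Negation using (contradiction; contradiction-irr)
open import Relation.Unary using (Pred; Decidable)

-- Semiring structure and scalar multiplication on noncommutative polynomials.

module FreeAlgebra {c ℓ} (K : CommutativeRing c ℓ) where

  open NoncommutativePolynomial K
  private
    module K = CommutativeRing K
    module +-CS = CommutativeSemigroupProperties K.+-commutativeSemigroup
    module *-CS = CommutativeSemigroupProperties K.*-commutativeSemigroup
  open SetoidReasoning K.setoid

  infixl 7 _⊛_

  -- The Cauchy product of noncommutative power series, which computes the
  -- coefficients of a product (coefficient-*).
  _⊛_ : (Word → K.Carrier) → (Word → K.Carrier) → Word → K.Carrier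
  (f ⊛ g) []      = f [] K.* g []
  (f ⊛ g) (x ∷ w) = f [] K.* g (x ∷ w) K.+ ((λ v → f (x ∷ v)) ⊛ g) w

  ⊛-cong : ∀ {f f′ g g′} → (∀ w → f w K.≈ f′ w) → (∀ w → g w K.≈ g′ w) →
           ∀ w → (f ⊛ g) w K.≈ (f′ ⊛ g′) w
  ⊛-cong f≈ g≈ []      = K.*-cong (f≈ []) (g≈ [])
  ⊛-cong f≈ g≈ (x ∷ w) =
    K.+-cong (K.*-cong (f≈ []) (g≈ (x ∷ w))) (⊛-cong (λ v → f≈ (x ∷ v)) g≈ w)

  ⊛-zeroˡ : ∀ g w → ((λ _ → K.0#) ⊛ g) w K.≈ K.0#
  ⊛-zeroˡ g []      = K.zeroˡ (g [])
  ⊛-zeroˡ g (x ∷ w) = K.trans (K.+-cong (K.zeroˡ (g (x ∷ w))) (⊛-zeroˡ g w)) (K.+-identityˡ K.0#)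

  ⊛-distribʳ : ∀ f f′ g w →
               ((λ v → f v K.+ f′ v) ⊛ g) w K.≈ (f ⊛ g) w K.+ (f′ ⊛ g) w
  ⊛-distribʳ f f′ g []      = K.distribʳ (g []) (f []) (f′ [])
  ⊛-distribʳ f f′ g (x ∷ w) = K.trans
    (K.+-cong (K.distribʳ (g (x ∷ w)) (f []) (f′ []))
              (⊛-distribʳ (λ v → f (x ∷ v)) (λ v → f′ (x ∷ v)) g w))
    (+-CS.interchange _ _ _ _)

  ⊛-distribˡ : ∀ f g g′ w →
               (f ⊛ (λ v → g v K.+ g′ v)) w K.≈ (f ⊛ g) w K.+ (f ⊛ g′) w
  ⊛-distribˡ f g g′ []      = K.distribˡ (f []) (g []) (g′ [])
  ⊛-distribˡ f g g′ (x ∷ w) = K.trans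
    (K.+-cong (K.distribˡ (f []) (g (x ∷ w)) (g′ (x ∷ w)))
              (⊛-distribˡ (λ v → f (x ∷ v)) g g′ w))
    (+-CS.interchange _ _ _ _)

  ⊛-scaleˡ : ∀ k f g w → ((λ v → k K.* f v) ⊛ g) w K.≈ k K.* (f ⊛ g) w
  ⊛-scaleˡ k f g []      = K.*-assoc k (f []) (g [])
  ⊛-scaleˡ k f g (x ∷ w) = K.trans
    (K.+-cong (K.*-assoc k (f []) (g (x ∷ w))) (⊛-scaleˡ k (λ v → f (x ∷ v)) g w))
    (K.sym (K.distribˡ k _ _))

  ⊛-scaleʳ : ∀ k f g w → (f ⊛ (λ v → k K.* g v)) w K.≈ k K.* (f ⊛ g) w
  ⊛-scaleʳ k f g []      = *-CS.x∙yz≈y∙xz (f []) k (g [])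
  ⊛-scaleʳ k f g (x ∷ w) = K.trans
    (K.+-cong (*-CS.x∙yz≈y∙xz (f []) k (g (x ∷ w))) (⊛-scaleʳ k (λ v → f (x ∷ v)) g w))
    (K.sym (K.distribˡ k _ _))

  -- Induction on the word. Stripping a first letter `x` turns `f ⊛ g` into `f [] K.* gₓ + fₓ ⊛ g`,
  -- a Leibniz rule. Distributivity and scaling then isolate `(fₓ ⊛ g) ⊛ h`, to which the induction
  -- hypothesis applies.
  ⊛-assoc : ∀ f g h w → ((f ⊛ g) ⊛ h) w K.≈ (f ⊛ (g ⊛ h)) w
  ⊛-assoc f g h []      = K.*-assoc (f []) (g []) (h [])
  ⊛-assoc f g h (x ∷ w) = begin
    f [] K.* g [] K.* h (x ∷ w) K.+ ((λ v → f [] K.* gₓ v K.+ (fₓ ⊛ g) v) ⊛ h) w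
      ≈⟨ K.+-cong (K.*-assoc _ _ _) (⊛-distribʳ (λ v → f [] K.* gₓ v) (fₓ ⊛ g) h w) ⟩
    f [] K.* (g [] K.* h (x ∷ w)) K.+ (((λ v → f [] K.* gₓ v) ⊛ h) w K.+ ((fₓ ⊛ g) ⊛ h) w)
      ≈⟨ K.+-congˡ (K.+-cong (⊛-scaleˡ (f []) gₓ h w) (⊛-assoc fₓ g h w)) ⟩
    f [] K.* (g [] K.* h (x ∷ w)) K.+ (f [] K.* (gₓ ⊛ h) w K.+ (fₓ ⊛ (g ⊛ h)) w)
      ≈⟨ K.+-assoc _ _ _ ⟨
    f [] K.* (g [] K.* h (x ∷ w)) K.+ f [] K.* (gₓ ⊛ h) w K.+ (fₓ ⊛ (g ⊛ h)) w
      ≈⟨ K.+-congʳ (K.sym (K.distribˡ _ _ _)) ⟩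
    f [] K.* (g ⊛ h) (x ∷ w) K.+ (fₓ ⊛ (g ⊛ h)) w ∎
    where
    fₓ = λ v → f (x ∷ v)
    gₓ = λ v → g (x ∷ v)

  coefficient-+ : ∀ p q w → coefficient (p + q) w K.≈ coefficient p w K.+ coefficient q w
  coefficient-+ []            q w = K.sym (K.+-identityˡ _)
  coefficient-+ ((k , v) ∷ p) q w with does (v ≟ʷ w)
  ... | true  = K.trans (K.+-congˡ (coefficient-+ p q w)) (K.sym (K.+-assoc _ _ _))
  ... | false = coefficient-+ p q w

  coefficient-· : ∀ k p w → coefficient (k · p) w K.≈ k K.* coefficient p w
  coefficient-· k []            w = K.sym (K.zeroʳ k)
  coefficient-· k ((l , v) ∷ p) w with does (v ≟ʷ w)
  ... | true  = K.trans (K.+-congˡ (coefficient-· k p w)) (K.sym (K.distribˡ _ _ _))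
  ... | false = coefficient-· k p w

  constant-⊛ : ∀ k g w → (coefficient ((k , []) ∷ []) ⊛ g) w K.≈ k K.* g w
  constant-⊛ k g []      = K.*-congʳ (K.+-identityʳ k)
  constant-⊛ k g (x ∷ w) = K.trans
    (K.+-cong (K.*-congʳ (K.+-identityʳ k)) (⊛-zeroˡ g w)) (K.+-identityʳ _)

  ⊛-identityʳ : ∀ f w → (f ⊛ coefficient 1ₚ) w K.≈ f w
  ⊛-identityʳ f []      = K.trans (K.*-congˡ (K.+-identityʳ K.1#)) (K.*-identityʳ _)
  ⊛-identityʳ f (x ∷ w) = K.trans
    (K.+-cong (K.zeroʳ (f [])) (⊛-identityʳ (λ v → f (x ∷ v)) w)) (K.+-identityˡ _)

  coefficient-∷-[] : ∀ x p → coefficient (map (map₂ (x ∷_)) p) [] ≡ K.0#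
  coefficient-∷-[] x []      = ≡.refl
  coefficient-∷-[] x (_ ∷ p) = coefficient-∷-[] x p

  -- Both letters are split into cases so that the decision of `x ∷ v` against `y ∷ w` computes: to
  -- the decision of `v` against `w` for equal letters, to `false` otherwise.
  coefficient-∷-∷ : ∀ x p y w → coefficient (map (map₂ (x ∷_)) p) (y ∷ w) ≡
                    (if does (x ≟ˡ y) then coefficient p w else K.0#)
  coefficient-∷-∷ 𝐚 []            𝐚 w = ≡.refl
  coefficient-∷-∷ 𝐚 []            𝐛 w = ≡.refl
  coefficient-∷-∷ 𝐛 []            𝐚 w = ≡.refl
  coefficient-∷-∷ 𝐛 []            𝐛 w = ≡.refl
  coefficient-∷-∷ 𝐚 (_ ∷ p)       𝐛 w = coefficient-∷-∷ 𝐚 p 𝐛 w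
  coefficient-∷-∷ 𝐛 (_ ∷ p)       𝐚 w = coefficient-∷-∷ 𝐛 p 𝐚 w
  coefficient-∷-∷ 𝐚 ((k , v) ∷ p) 𝐚 w =
    ≡.cong (λ r → if does (v ≟ʷ w) then k K.+ r else r) (coefficient-∷-∷ 𝐚 p 𝐚 w)
  coefficient-∷-∷ 𝐛 ((k , v) ∷ p) 𝐛 w =
    ≡.cong (λ r → if does (v ≟ʷ w) then k K.+ r else r) (coefficient-∷-∷ 𝐛 p 𝐛 w)

  -- Induction on `u`: a constant acts by scaling, and a leading letter `x` of `u` shifts both sides
  -- in the same way.
  monomial-* : ∀ k u q w →
    coefficient (map (λ (l , v) → (k K.* l , u ++ v)) q) w K.≈
    (coefficient ((k , u) ∷ []) ⊛ coefficient q) w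
  monomial-* k []      q w = K.trans (coefficient-· k q w) (K.sym (constant-⊛ k (coefficient q) w))
  monomial-* k (x ∷ u) q w
    -- Exhibits the product as `x` prepended to every word of `uq`. The monomial on the right is, by
    -- computation, `x` prepended to `m`.
    rewrite map-∘ {g = map₂ (x ∷_)} {f = λ (l , v) → (k K.* l , u ++ v)} q = shifted w
    where
    m  = (k , u) ∷ []
    uq = map (λ (l , v) → (k K.* l , u ++ v)) q
    shifted : ∀ w → coefficient (map (map₂ (x ∷_)) uq) w K.≈
              (coefficient (map (map₂ (x ∷_)) m) ⊛ coefficient q) w
    shifted []      = K.trans (K.reflexive (coefficient-∷-[] x uq)) (K.sym (K.zeroˡ _))
    shifted (y ∷ w) = begin
      coefficient (map (map₂ (x ∷_)) uq) (y ∷ w)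
        ≡⟨ coefficient-∷-∷ x uq y w ⟩
      (if does (x ≟ˡ y) then coefficient uq w else K.0#)
        ≈⟨ branches (does (x ≟ˡ y)) ⟩
      ((λ v → if does (x ≟ˡ y) then coefficient m v else K.0#) ⊛ coefficient q) w
        ≈⟨ ⊛-cong (λ v → K.reflexive (coefficient-∷-∷ x m y v)) (λ _ → K.refl) w ⟨
      ((λ v → coefficient (map (map₂ (x ∷_)) m) (y ∷ v)) ⊛ coefficient q) w
        ≈⟨ K.+-identityˡ _ ⟨
      K.0# K.+ ((λ v → coefficient (map (map₂ (x ∷_)) m) (y ∷ v)) ⊛ coefficient q) w
        ≈⟨ K.+-congʳ (K.zeroˡ _) ⟨
      (coefficient (map (map₂ (x ∷_)) m) ⊛ coefficient q) (y ∷ w) ∎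
      where
      -- The Boolean is generalised because on the right it occurs under the binder of the series.
      branches : ∀ d →
        (if d then coefficient uq w else K.0#) K.≈
        ((λ v → if d then coefficient m v else K.0#) ⊛ coefficient q) w
      branches true  = monomial-* k u q w
      branches false = K.sym (⊛-zeroˡ (coefficient q) w)

  -- Linearity in the left factor reduces this to monomials. Through it, congruence, associativity
  -- and the other laws of `*` up to `≈` follow from those of `⊛`, whatever lists represent the
  -- polynomials.
  coefficient-* : ∀ p q w → coefficient (p * q) w K.≈ (coefficient p ⊛ coefficient q) w
  coefficient-* []            q w = K.sym (⊛-zeroˡ (coefficient q) w)
  coefficient-* ((k , u) ∷ p) q w = begin
    coefficient (map (λ (l , v) → (k K.* l , u ++ v)) q + p * q) w
      ≈⟨ coefficient-+ (map (λ (l , v) → (k K.* l , u ++ v)) q) (p * q) w ⟩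
    coefficient (map (λ (l , v) → (k K.* l , u ++ v)) q) w K.+ coefficient (p * q) w
      ≈⟨ K.+-cong (monomial-* k u q w) (coefficient-* p q w) ⟩
    (coefficient m ⊛ coefficient q) w K.+ (coefficient p ⊛ coefficient q) w
      ≈⟨ ⊛-distribʳ (coefficient m) (coefficient p) (coefficient q) w ⟨
    ((λ v → coefficient m v K.+ coefficient p v) ⊛ coefficient q) w
      ≈⟨ ⊛-cong (coefficient-+ m p) (λ _ → K.refl) w ⟨
    (coefficient ((k , u) ∷ p) ⊛ coefficient q) w ∎
    where m = (k , u) ∷ []

  +-cong : ∀ {p p′ q q′} → p ≈ p′ → q ≈ q′ → p + q ≈ p′ + q′
  +-cong {p} {p′} {q} {q′} p≈ q≈ w = begin
    coefficient (p + q) w                 ≈⟨ coefficient-+ p q w ⟩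
    coefficient p w K.+ coefficient q w   ≈⟨ K.+-cong (p≈ w) (q≈ w) ⟩
    coefficient p′ w K.+ coefficient q′ w ≈⟨ coefficient-+ p′ q′ w ⟨
    coefficient (p′ + q′) w               ∎

  +-comm : ∀ p q → p + q ≈ q + p
  +-comm p q w = begin
    coefficient (p + q) w               ≈⟨ coefficient-+ p q w ⟩
    coefficient p w K.+ coefficient q w ≈⟨ K.+-comm _ _ ⟩
    coefficient q w K.+ coefficient p w ≈⟨ coefficient-+ q p w ⟨
    coefficient (q + p) w               ∎

  *-cong : ∀ {p p′ q q′} → p ≈ p′ → q ≈ q′ → p * q ≈ p′ * q′
  *-cong {p} {p′} {q} {q′} p≈ q≈ w = begin
    coefficient (p * q) w                 ≈⟨ coefficient-* p q w ⟩
    (coefficient p ⊛ coefficient q) w     ≈⟨ ⊛-cong p≈ q≈ w ⟩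
    (coefficient p′ ⊛ coefficient q′) w   ≈⟨ coefficient-* p′ q′ w ⟨
    coefficient (p′ * q′) w               ∎

  *-assoc : ∀ p q r → (p * q) * r ≈ p * (q * r)
  *-assoc p q r w = begin
    coefficient ((p * q) * r) w
      ≈⟨ coefficient-* (p * q) r w ⟩
    (coefficient (p * q) ⊛ coefficient r) w
      ≈⟨ ⊛-cong (coefficient-* p q) (λ _ → K.refl) w ⟩
    ((coefficient p ⊛ coefficient q) ⊛ coefficient r) w
      ≈⟨ ⊛-assoc (coefficient p) (coefficient q) (coefficient r) w ⟩
    (coefficient p ⊛ (coefficient q ⊛ coefficient r)) w
      ≈⟨ ⊛-cong (λ _ → K.refl) (coefficient-* q r) w ⟨
    (coefficient p ⊛ coefficient (q * r)) w
      ≈⟨ coefficient-* p (q * r) w ⟨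
    coefficient (p * (q * r)) w ∎

  *-identityˡ : ∀ p → 1ₚ * p ≈ p
  *-identityˡ p w = K.trans (coefficient-* 1ₚ p w)
    (K.trans (constant-⊛ K.1# (coefficient p) w) (K.*-identityˡ _))

  *-identityʳ : ∀ p → p * 1ₚ ≈ p
  *-identityʳ p w = K.trans (coefficient-* p 1ₚ w) (⊛-identityʳ (coefficient p) w)

  *-distribˡ : ∀ p q r → p * (q + r) ≈ p * q + p * r
  *-distribˡ p q r w = begin
    coefficient (p * (q + r)) w
      ≈⟨ coefficient-* p (q + r) w ⟩
    (coefficient p ⊛ coefficient (q + r)) w
      ≈⟨ ⊛-cong (λ _ → K.refl) (coefficient-+ q r) w ⟩
    (coefficient p ⊛ (λ v → coefficient q v K.+ coefficient r v)) w
      ≈⟨ ⊛-distribˡ (coefficient p) (coefficient q) (coefficient r) w ⟩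
    (coefficient p ⊛ coefficient q) w K.+ (coefficient p ⊛ coefficient r) w
      ≈⟨ K.+-cong (coefficient-* p q w) (coefficient-* p r w) ⟨
    coefficient (p * q) w K.+ coefficient (p * r) w
      ≈⟨ coefficient-+ (p * q) (p * r) w ⟨
    coefficient (p * q + p * r) w ∎

  *-distribʳ : ∀ p q r → (q + r) * p ≈ q * p + r * p
  *-distribʳ p q r w = begin
    coefficient ((q + r) * p) w
      ≈⟨ coefficient-* (q + r) p w ⟩
    (coefficient (q + r) ⊛ coefficient p) w
      ≈⟨ ⊛-cong (coefficient-+ q r) (λ _ → K.refl) w ⟩
    ((λ v → coefficient q v K.+ coefficient r v) ⊛ coefficient p) w
      ≈⟨ ⊛-distribʳ (coefficient q) (coefficient r) (coefficient p) w ⟩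
    (coefficient q ⊛ coefficient p) w K.+ (coefficient r ⊛ coefficient p) w
      ≈⟨ K.+-cong (coefficient-* q p w) (coefficient-* r p w) ⟨
    coefficient (q * p) w K.+ coefficient (r * p) w
      ≈⟨ coefficient-+ (q * p) (r * p) w ⟨
    coefficient (q * p + r * p) w ∎

  *-zeroʳ : ∀ p → p * 0ₚ ≡ 0ₚ
  *-zeroʳ []      = ≡.refl
  *-zeroʳ (_ ∷ p) = *-zeroʳ p

  -- Gives access to generic laws of sums and powers; `a + - b` is treated there as an opaque
  -- element.
  polynomialSemiring : Semiring c ℓ
  polynomialSemiring = record
    { Carrier = Polynomial ; _≈_ = _≈_ ; _+_ = _+_ ; _*_ = _*_ ; 0# = 0ₚ ; 1# = 1ₚ
    ; isSemiring = record
      { isSemiringWithoutAnnihilatingZero = record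
        { +-isCommutativeMonoid = record
          { isMonoid = record
            { isSemigroup = record
              { isMagma = record
                { isEquivalence = record
                  { refl  = λ _ → K.refl
                  ; sym   = λ p≈q w → K.sym (p≈q w)
                  ; trans = λ p≈q q≈r w → K.trans (p≈q w) (q≈r w)
                  }
                ; ∙-cong = λ {p} {p′} {q} {q′} → +-cong {p} {p′} {q} {q′}
                }
              ; assoc = λ p q r w → K.reflexive (≡.cong (λ s → coefficient s w) (++-assoc p q r))
              }
            ; identity = (λ _ _ → K.refl)
                       , (λ p w → K.reflexive (≡.cong (λ s → coefficient s w) (++-identityʳ p)))
            }
          ; comm = +-comm
          }
        ; *-cong     = λ {p} {p′} {q} {q′} → *-cong {p} {p′} {q} {q′}
        ; *-assoc    = *-assoc
        ; *-identity = *-identityˡ , *-identityʳ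
        ; distrib    = *-distribˡ , *-distribʳ
        }
      ; zero = (λ _ _ → K.refl)
             , (λ p w → K.reflexive (≡.cong (λ s → coefficient s w) (*-zeroʳ p)))
      }
    }

  ·-cong : ∀ k p q → p ≈ q → k · p ≈ k · q
  ·-cong k p q p≈q w =
    K.trans (coefficient-· k p w) (K.trans (K.*-congˡ (p≈q w)) (K.sym (coefficient-· k q w)))

  ·-*-assoc : ∀ k p q → (k · p) * q ≈ k · (p * q)
  ·-*-assoc k p q w = begin
    coefficient ((k · p) * q) w
      ≈⟨ coefficient-* (k · p) q w ⟩
    (coefficient (k · p) ⊛ coefficient q) w
      ≈⟨ ⊛-cong (coefficient-· k p) (λ _ → K.refl) w ⟩
    ((λ v → k K.* coefficient p v) ⊛ coefficient q) w
      ≈⟨ ⊛-scaleˡ k (coefficient p) (coefficient q) w ⟩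
    k K.* (coefficient p ⊛ coefficient q) w
      ≈⟨ K.*-congˡ (coefficient-* p q w) ⟨
    k K.* coefficient (p * q) w
      ≈⟨ coefficient-· k (p * q) w ⟨
    coefficient (k · (p * q)) w ∎

  -- Commutativity of `K` enters through `⊛-scaleʳ`, which moves `l` past the coefficients of `p`.
  ·-*-interchange : ∀ k l p q → (k K.* l) · (p * q) ≈ (k · p) * (l · q)
  ·-*-interchange k l p q w = begin
    coefficient ((k K.* l) · (p * q)) w
      ≈⟨ coefficient-· (k K.* l) (p * q) w ⟩
    k K.* l K.* coefficient (p * q) w
      ≈⟨ K.trans (K.*-assoc k l _) (K.*-congˡ (K.*-congˡ (coefficient-* p q w))) ⟩
    k K.* (l K.* (coefficient p ⊛ coefficient q) w)
      ≈⟨ K.*-congˡ (⊛-scaleʳ l (coefficient p) (coefficient q) w) ⟨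
    k K.* (coefficient p ⊛ (λ v → l K.* coefficient q v)) w
      ≈⟨ ⊛-scaleˡ k (coefficient p) (λ v → l K.* coefficient q v) w ⟨
    ((λ v → k K.* coefficient p v) ⊛ (λ v → l K.* coefficient q v)) w
      ≈⟨ ⊛-cong (coefficient-· k p) (coefficient-· l q) w ⟨
    (coefficient (k · p) ⊛ coefficient (l · q)) w
      ≈⟨ coefficient-* (k · p) (l · q) w ⟨
    coefficient ((k · p) * (l · q)) w ∎

-- Finite sums in a semiring.

module SumOver {s t} (R : Semiring s t) where

  open Semiring R
  open SetoidReasoning setoid

  private variable
    i j : Level
    A : Set i
    B : Set j

  ∑ : (A → Carrier) → List A → Carrier
  ∑ f xs = foldr _+_ 0# (map f xs)

  ∑-cong : ∀ {f g : A → Carrier} → (∀ x → f x ≈ g x) → ∀ xs → ∑ f xs ≈ ∑ g xs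
  ∑-cong f≈g []       = refl
  ∑-cong f≈g (x ∷ xs) = +-cong (f≈g x) (∑-cong f≈g xs)

  ∑-zero : ∀ {f : A → Carrier} → (∀ x → f x ≈ 0#) → ∀ xs → ∑ f xs ≈ 0#
  ∑-zero f≈0 []       = refl
  ∑-zero f≈0 (x ∷ xs) = trans (+-cong (f≈0 x) (∑-zero f≈0 xs)) (+-identityˡ 0#)

  ∑-++ : ∀ (f : A → Carrier) xs ys → ∑ f (xs ++ ys) ≈ ∑ f xs + ∑ f ys
  ∑-++ f []       ys = sym (+-identityˡ _)
  ∑-++ f (x ∷ xs) ys = trans (+-congˡ (∑-++ f xs ys)) (sym (+-assoc _ _ _))

  ∑-map : ∀ (f : B → Carrier) (g : A → B) xs → ∑ f (map g xs) ≈ ∑ (λ x → f (g x)) xs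
  ∑-map f g []       = refl
  ∑-map f g (x ∷ xs) = +-congˡ (∑-map f g xs)

  ∑-concatMap : ∀ (f : B → Carrier) (g : A → List B) xs →
                ∑ f (concatMap g xs) ≈ ∑ (λ x → ∑ f (g x)) xs
  ∑-concatMap f g []       = refl
  ∑-concatMap f g (x ∷ xs) = trans (∑-++ f (g x) _) (+-congˡ (∑-concatMap f g xs))

  ∑-⊎ : ∀ (f : A ⊎ B → Carrier) xs ys →
        ∑ f (map inj₁ xs ++ map inj₂ ys) ≈ ∑ (λ x → f (inj₁ x)) xs + ∑ (λ y → f (inj₂ y)) ys
  ∑-⊎ f xs ys = trans (∑-++ f (map inj₁ xs) (map inj₂ ys))
    (+-cong (∑-map f inj₁ xs) (∑-map f inj₂ ys))

  *-distribˡ-∑ : ∀ k (f : A → Carrier) xs → k * ∑ f xs ≈ ∑ (λ x → k * f x) xs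
  *-distribˡ-∑ k f []       = zeroʳ k
  *-distribˡ-∑ k f (x ∷ xs) = trans (distribˡ _ _ _) (+-congˡ (*-distribˡ-∑ k f xs))

  *-distribʳ-∑ : ∀ k (f : A → Carrier) xs → ∑ f xs * k ≈ ∑ (λ x → f x * k) xs
  *-distribʳ-∑ k f []       = zeroˡ k
  *-distribʳ-∑ k f (x ∷ xs) = trans (distribʳ _ _ _) (+-congˡ (*-distribʳ-∑ k f xs))

  -- Bridges two index sets: the elements of `P ⋆ Q` come from posets with one point removed,
  -- whereas chain sums in `P` and `Q` run over all elements. The removed point contributes zero.
  ∑-restrict : ∀ {q} {P : Pred A q} (P? : Decidable P)
               {f : Refinement A P → Carrier} {g : A → Carrier} →
               (∀ x .(px : P x) → f (x , irr px) ≈ g x) → (∀ x → ¬ P x → g x ≈ 0#) →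
               ∀ xs → ∑ f (restrict P? xs) ≈ ∑ g xs
  ∑-restrict P? f≈g g≈0 []       = refl
  ∑-restrict P? f≈g g≈0 (x ∷ xs) with P? x
  ... | yes px = +-cong (f≈g x px) (∑-restrict P? f≈g g≈0 xs)
  ... | no ¬px = trans (∑-restrict P? f≈g g≈0 xs)
                   (trans (sym (+-identityˡ _)) (+-congʳ (sym (g≈0 x ¬px))))

-- First-step recursion for the list of chains.

module ChainLists {c ℓ} (K : CommutativeRing c ℓ) {p r} (P : QuasiGraded.QuasiGradedPoset K p r) where

  open QuasiGraded.QuasiGradedPoset P

  private
    empty : ∀ {x y} → ρ y ℕ.≤ ρ x → (cs : List (Chain x y)) → cs ≡ []
    empty ρy≤ρx []      = ≡.refl
    empty ρy≤ρx (γ ∷ _) = contradiction (chain⇒ρ< γ) (ℕ.≤⇒≯ ρy≤ρx)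

  chains-empty : ∀ {x y} → ρ y ℕ.≤ ρ x → chains x y ≡ []
  chains-empty ρy≤ρx = empty ρy≤ρx (chains _ _)

  -- Each step raises `ρ` by at least one, so a bound sufficient at `x` is, less one, sufficient at
  -- any `z` above `x`. A sufficient bound of zero means `ρ y ≤ ρ x`, and then there are no chains
  -- at all.
  chainsUpTo-stable : ∀ m n {x y} → ρ y ℕ.≤ m ℕ.+ ρ x → ρ y ℕ.≤ n ℕ.+ ρ x →
                      chainsUpTo m x y ≡ chainsUpTo n x y
  chainsUpTo-stable zero    n       {x} {y} h k = ≡.sym (empty h (chainsUpTo n x y))
  chainsUpTo-stable (suc m) zero    {x} {y} h k = empty k (chainsUpTo (suc m) x y)
  chainsUpTo-stable (suc m) (suc n) {x} {y} h k =
    ≡.cong (singleStep x y ++_) (concatMap-cong tails elements)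
    where
    tails : ∀ z → prepend x z (chainsUpTo m z y) ≡ prepend x z (chainsUpTo n z y)
    tails z with x <? z
    ... | no  _   = ≡.refl
    ... | yes x<z = ≡.cong (map (x<z ∷_)) (chainsUpTo-stable m n (later m h) (later n k))
      where
      later : ∀ l → ρ y ℕ.≤ suc l ℕ.+ ρ x → ρ y ℕ.≤ l ℕ.+ ρ z
      later l h = ℕ.≤-trans h
        (≡.subst (ℕ._≤ l ℕ.+ ρ z) (ℕ.+-suc l (ρ x)) (ℕ.+-monoʳ-≤ l (ρ-strictMono x<z)))

  chains-unfold : ∀ x y → chains x y ≡
                  singleStep x y ++ concatMap (λ z → prepend x z (chains z y)) elements
  chains-unfold x y = ≡.trans
    -- The bounds in `chains x y` and `chains z y` depend on the starting point. The common bound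
    -- `suc (ρ y)` suffices at `x` and leaves `ρ y` after one step, which suffices at every `z`.
    (chainsUpTo-stable ρ[ x , y ] (suc (ρ y)) (ρ≤ρ[]+ρ x y) (ℕ.m≤n⇒m≤1+n (ℕ.m≤m+n _ _)))
    (≡.cong (singleStep x y ++_) (concatMap-cong tails elements))
    where
    ρ≤ρ[]+ρ : ∀ x y → ρ y ℕ.≤ ρ[ x , y ] ℕ.+ ρ x
    ρ≤ρ[]+ρ x y = ≡.subst (ρ y ℕ.≤_) (ℕ.+-comm (ρ x) _) (ℕ.m≤n+m∸n (ρ y) (ρ x))

    tails : ∀ z → prepend x z (chainsUpTo (ρ y) z y) ≡ prepend x z (chains z y)
    tails z = ≡.cong (prepend x z)
      (chainsUpTo-stable (ρ y) ρ[ z , y ] (ℕ.m≤m+n _ _) (ρ≤ρ[]+ρ z y))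

-- Weighted sums over chains.

-- The step weights stand for ζ̄(x , y) (𝐚 - 𝐛)^(ρ(x , y) - 1).
module ChainSum
  {c ℓ} (K : CommutativeRing c ℓ) {p r} (P : QuasiGraded.QuasiGradedPoset K p r)
  {s t} (R : Semiring s t) (b : Semiring.Carrier R)
  (step : ∀ x y → .(QuasiGraded.QuasiGradedPoset._<_ P x y) → Semiring.Carrier R)
  where

  open QuasiGraded.QuasiGradedPoset P hiding (Carrier)
  open ChainLists K P
  open Semiring R hiding (zero)
  open SumOver R
  open SetoidReasoning setoid

  weight : ∀ {x y} → Chain x y → Carrier
  weight ([_] {x} {y} x<y)   = step x y x<y
  weight (_∷_ {x} {z} x<z γ) = step x z x<z * b * weight γ

  chainSum : ∀ x y → Carrier
  chainSum x y = ∑ weight (chains x y)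

  edge : ∀ x y → Carrier
  edge x y with x <? y
  ... | yes x<y = step x y x<y
  ... | no  _   = 0#

  edge-< : ∀ {x y} .(x<y : x < y) → edge x y ≈ step x y x<y
  edge-< {x} {y} x<y with x <? y
  ... | yes _   = refl
  ... | no  x≮y = contradiction-irr x<y x≮y

  edge-≮ : ∀ {x y} → ¬ x < y → edge x y ≈ 0#
  edge-≮ {x} {y} x≮y with x <? y
  ... | yes x<y = contradiction x<y x≮y
  ... | no  _   = refl

  chainSum-empty : ∀ {x y} → ρ y ℕ.≤ ρ x → chainSum x y ≈ 0#
  chainSum-empty ρy≤ρx = reflexive (≡.cong (∑ weight) (chains-empty ρy≤ρx))

  -- Lets an induction hypothesis available only for `x < z` be used under a sum over all `z`:
  -- elsewhere the edge is zero and both products vanish.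
  edge-*-cong : ∀ {x z e v w} → e ≈ edge x z → (x < z → v ≈ w) → e * b * v ≈ edge x z * b * w
  edge-*-cong {x} {z} {e} {v} {w} e≈ v≈w with x <? z
  ... | yes x<z = *-cong (*-congʳ e≈) (v≈w x<z)
  ... | no  _   = begin
    e * b * v  ≈⟨ *-congʳ (trans (*-congʳ e≈) (zeroˡ b)) ⟩
    0# * v     ≈⟨ trans (zeroˡ v) (sym (zeroˡ w)) ⟩
    0# * w     ≈⟨ *-congʳ (zeroˡ b) ⟨
    0# * b * w ∎

  chainSum-unfold : ∀ x y → chainSum x y ≈ edge x y + ∑ (λ z → edge x z * b * chainSum z y) elements
  chainSum-unfold x y = begin
    ∑ weight (chains x y)
      ≡⟨ ≡.cong (∑ weight) (chains-unfold x y) ⟩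
    ∑ weight (singleStep x y ++ concatMap longer elements)
      ≈⟨ ∑-++ weight (singleStep x y) (concatMap longer elements) ⟩
    ∑ weight (singleStep x y) + ∑ weight (concatMap longer elements)
      ≈⟨ +-cong single (trans (∑-concatMap weight longer elements) (∑-cong first elements)) ⟩
    edge x y + ∑ (λ z → edge x z * b * chainSum z y) elements ∎
    where
    longer : ∀ z → List (Chain x y)
    longer z = prepend x z (chains z y)

    single : ∑ weight (singleStep x y) ≈ edge x y
    single with x <? y
    ... | yes _ = +-identityʳ _
    ... | no  _ = refl

    first : ∀ z → ∑ weight (longer z) ≈ edge x z * b * chainSum z y
    first z with x <? z
    ... | yes x<z = trans (∑-map weight (x<z ∷_) (chains z y))
                      (sym (*-distribˡ-∑ (step x z x<z * b) weight (chains z y)))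
    ... | no  _   = sym (trans (*-congʳ (zeroˡ b)) (zeroˡ _))

-- Induction downwards from the maximal element.

module UpwardInduction {c ℓ} (K : CommutativeRing c ℓ) {p r}
  (P : QuasiGraded.BoundedQuasiGradedPoset K p r) where

  open QuasiGraded.BoundedQuasiGradedPoset P

  ρ≤ρ1̂ : ∀ x → ρ x ℕ.≤ ρ 1̂
  ρ≤ρ1̂ x with x ≟ 1̂
  ... | yes ≡.refl = ℕ.≤-refl
  ... | no  x≢1̂  = ℕ.<⇒≤ (ρ-strictMono (maximum x , x≢1̂))

  -- The measure is `ρ 1̂ ∸ ρ x`. By `ρ≤ρ1̂` the subtraction is never truncated, so the measure
  -- drops strictly along `x < z`.
  upwardInduction : ∀ {q} (T : Carrier → Set q) → (∀ x → (∀ z → x < z → T z) → T x) → ∀ x → T x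
  upwardInduction T rec x = go (suc (ρ 1̂ ∸ ρ x)) x ℕ.≤-refl
    where
    go : ∀ n x → ρ 1̂ ∸ ρ x ℕ.< n → T x
    go (suc n) x h = rec x λ z x<z →
      go n z (ℕ.<-≤-trans (ℕ.∸-monoʳ-< (ρ-strictMono x<z) (ρ≤ρ1̂ z)) (ℕ.s≤s⁻¹ h))

-- Multiplicativity of chain sums under the Stanley product.

module StanleyChainSum {c ℓ} (K : CommutativeRing c ℓ) {p₁ r₁ p₂ r₂}
  (P : QuasiGraded.BoundedQuasiGradedPoset K p₁ r₁) (Q : QuasiGraded.BoundedQuasiGradedPoset K p₂ r₂)
  {s t} (R : Semiring s t) where

  open QuasiGraded K using (BoundedQuasiGradedPoset; _⋆_; module StanleyProduct)
  open StanleyProduct P Q using (≢1̂?; ≢0̂?)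
  open Semiring R
  open SumOver R
  open SetoidReasoning setoid
  private
    module P = BoundedQuasiGradedPoset P
    module Q = BoundedQuasiGradedPoset Q
    module P⋆Q = BoundedQuasiGradedPoset (P ⋆ Q)

  -- The step weights are kept abstract: the argument sees them only through three compatibilities,
  -- of which `step₁₂` says that a step from `P` into `Q` factors through `P.1̂` and `Q.0̂`.
  module Multiplicative
    (b : Carrier)
    (stepP : ∀ x y → .(x P.< y) → Carrier)
    (stepQ : ∀ x y → .(x Q.< y) → Carrier)
    (stepP⋆Q : ∀ x y → .(x P⋆Q.< y) → Carrier)
    (step₁₁ : ∀ x y .(x<y : value x P.< value y) .(x<y′ : inj₁ x P⋆Q.< inj₁ y) →
              stepP⋆Q (inj₁ x) (inj₁ y) x<y′ ≈ stepP (value x) (value y) x<y)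
    (step₁₂ : ∀ x y .(x<1̂ : value x P.< P.1̂) .(0̂<y : Q.0̂ Q.< value y)
              .(x<y : inj₁ x P⋆Q.< inj₂ y) →
              stepP⋆Q (inj₁ x) (inj₂ y) x<y ≈ stepP (value x) P.1̂ x<1̂ * stepQ Q.0̂ (value y) 0̂<y)
    (step₂₂ : ∀ x y .(x<y : value x Q.< value y) .(x<y′ : inj₂ x P⋆Q.< inj₂ y) →
              stepP⋆Q (inj₂ x) (inj₂ y) x<y′ ≈ stepQ (value x) (value y) x<y)
    where

    module CP = ChainSum K P.quasiGradedPoset R b stepP
    module CQ = ChainSum K Q.quasiGradedPoset R b stepQ
    module CS = ChainSum K P⋆Q.quasiGradedPoset R b stepP⋆Q

    edge₁₁ : ∀ x y → CS.edge (inj₁ x) (inj₁ y) ≈ CP.edge (value x) (value y)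
    edge₁₁ x y with value x P.<? value y
    ... | yes x<y@(x≤y , x≢y) = trans (CS.edge-< x<y′) (step₁₁ x y x<y x<y′)
      where x<y′ = ₁∼₁ x≤y , λ e → x≢y (≡.cong value (inj₁-injective e))
    ... | no  x≮y = CS.edge-≮ λ (x≤y , x≢y) →
      x≮y (drop-inj₁ x≤y , λ e → x≢y (≡.cong inj₁ (value-injective e)))

    edge₂₂ : ∀ x y → CS.edge (inj₂ x) (inj₂ y) ≈ CQ.edge (value x) (value y)
    edge₂₂ x y with value x Q.<? value y
    ... | yes x<y@(x≤y , x≢y) = trans (CS.edge-< x<y′) (step₂₂ x y x<y x<y′)
      where x<y′ = ₂∼₂ x≤y , λ e → x≢y (≡.cong value (inj₂-injective e))
    ... | no  x≮y = CS.edge-≮ λ (x≤y , x≢y) →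
      x≮y (drop-inj₂ x≤y , λ e → x≢y (≡.cong inj₂ (value-injective e)))

    -- Since `P.1̂` and `Q.0̂` have been removed, `x < 1̂`, `0̂ < y` and `inj₁ x < inj₂ y` always
    -- hold. No edge here takes its default value zero, and `step₁₂` applies.
    edge₁₂ : ∀ x y → CS.edge (inj₁ x) (inj₂ y) ≈ CP.edge (value x) P.1̂ * CQ.edge Q.0̂ (value y)
    edge₁₂ x@(x′ , irr x≢1̂) y@(y′ , irr y≢0̂) = begin
      CS.edge (inj₁ x) (inj₂ y)              ≈⟨ CS.edge-< x<y ⟩
      stepP⋆Q (inj₁ x) (inj₂ y) x<y          ≈⟨ step₁₂ x y x<1̂ 0̂<y x<y ⟩
      stepP x′ P.1̂ x<1̂ * stepQ Q.0̂ y′ 0̂<y    ≈⟨ *-cong (CP.edge-< x<1̂) (CQ.edge-< 0̂<y) ⟨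
      CP.edge x′ P.1̂ * CQ.edge Q.0̂ y′        ∎
      where
      x<y : inj₁ x P⋆Q.< inj₂ y
      x<y = ₁∼₂ , λ ()
      x<1̂ : x′ P.< P.1̂
      -- The irrelevant `x≢1̂` cannot be applied to `e` to give a relevant result; instead `e`
      -- refutes its type.
      x<1̂ = P.maximum x′ , λ e → contradiction-irr x≢1̂ λ x≢1̂ → x≢1̂ e
      0̂<y : Q.0̂ Q.< y′
      0̂<y = Q.minimum y′ , λ e → contradiction-irr y≢0̂ λ y≢0̂ → y≢0̂ (≡.sym e)

    edge₂₁ : ∀ x y → CS.edge (inj₂ x) (inj₁ y) ≈ 0#
    edge₂₁ x y = CS.edge-≮ {inj₂ x} {inj₁ y} λ { (() , _) }

    private
      elements₁ = restrict ≢1̂? P.elements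
      elements₂ = restrict ≢0̂? Q.elements

    chainSum-unfold-⋆ : ∀ x → CS.chainSum x P⋆Q.1̂ ≈ CS.edge x P⋆Q.1̂ +
      (∑ (λ z → CS.edge x (inj₁ z) * b * CS.chainSum (inj₁ z) P⋆Q.1̂) elements₁ +
       ∑ (λ z → CS.edge x (inj₂ z) * b * CS.chainSum (inj₂ z) P⋆Q.1̂) elements₂)
    chainSum-unfold-⋆ x = trans (CS.chainSum-unfold x P⋆Q.1̂)
      (+-congˡ (∑-⊎ (λ z → CS.edge x z * b * CS.chainSum z P⋆Q.1̂) elements₁ elements₂))

    -- No step leads from `Q` back into `P`, and no step of `Q` ends in the removed `0̂`, so the
    -- recursions agree. The condition `y≢0̂` is part of the induction motive, which lets the
    -- induction run over all of `Q`.
    chainSum-inj₂ : ∀ y .(y≢0̂ : y ≢ Q.0̂) →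
                    CS.chainSum (inj₂ (y , irr y≢0̂)) P⋆Q.1̂ ≈ CQ.chainSum y Q.1̂
    chainSum-inj₂ = UpwardInduction.upwardInduction K Q _ λ y ih y≢0̂ →
      let y′ = y , irr y≢0̂ in begin
      CS.chainSum (inj₂ y′) P⋆Q.1̂
        ≈⟨ trans (chainSum-unfold-⋆ (inj₂ y′)) (+-congʳ (edge₂₂ y′ _)) ⟩
      CQ.edge y Q.1̂ +
        (∑ (λ z → CS.edge (inj₂ y′) (inj₁ z) * b * CS.chainSum (inj₁ z) P⋆Q.1̂) elements₁ +
         ∑ (λ z → CS.edge (inj₂ y′) (inj₂ z) * b * CS.chainSum (inj₂ z) P⋆Q.1̂) elements₂)
        ≈⟨ +-congˡ (+-cong
             (∑-zero (λ z → trans (*-congʳ (trans (*-congʳ (edge₂₁ y′ z)) (zeroˡ b))) (zeroˡ _)) elements₁)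
             (∑-restrict ≢0̂?
               (λ z z≢0̂ → CQ.edge-*-cong (edge₂₂ y′ (z , irr z≢0̂)) λ y<z → ih z y<z z≢0̂)
               (λ z ¬z≢0̂ → below-0̂ y z (decidable-stable (z Q.≟ Q.0̂) ¬z≢0̂)) Q.elements)) ⟩
      CQ.edge y Q.1̂ + (0# + ∑ (λ z → CQ.edge y z * b * CQ.chainSum z Q.1̂) Q.elements)
        ≈⟨ +-congˡ (+-identityˡ _) ⟩
      CQ.edge y Q.1̂ + ∑ (λ z → CQ.edge y z * b * CQ.chainSum z Q.1̂) Q.elements
        ≈⟨ CQ.chainSum-unfold y Q.1̂ ⟨
      CQ.chainSum y Q.1̂ ∎
      where
      below-0̂ : ∀ y z {v} → z ≡ Q.0̂ → CQ.edge y z * b * v ≈ 0#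
      below-0̂ y z z≡0̂ = trans (*-congʳ (trans (*-congʳ (CQ.edge-≮ y≮z)) (zeroˡ b))) (zeroˡ _)
        where
        y≮z : ¬ y Q.< z
        y≮z (y≤z , y≢z) rewrite z≡0̂ = y≢z (Q.antisym y≤z (Q.minimum y))

    -- Steps staying in `P` acquire the factor `CQ.chainSum Q.0̂ Q.1̂` by induction. Steps into `Q`,
    -- including the one straight to the top, all carry the factor `e`, and what remains is the
    -- first-step expansion at `Q.0̂`.
    chainSum-inj₁ : ∀ x .(x≢1̂ : x ≢ P.1̂) →
      CS.chainSum (inj₁ (x , irr x≢1̂)) P⋆Q.1̂ ≈ CP.chainSum x P.1̂ * CQ.chainSum Q.0̂ Q.1̂
    chainSum-inj₁ = UpwardInduction.upwardInduction K P _ λ x ih x≢1̂ →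
      let x′ = x , irr x≢1̂
          e  = CP.edge x P.1̂
          p  = ∑ (λ z → CP.edge x z * b * CP.chainSum z P.1̂) P.elements
          q  = ∑ (λ z → CQ.edge Q.0̂ z * b * CQ.chainSum z Q.1̂) Q.elements
      in begin
      CS.chainSum (inj₁ x′) P⋆Q.1̂
        ≈⟨ trans (chainSum-unfold-⋆ (inj₁ x′)) (+-congʳ (edge₁₂ x′ _)) ⟩
      e * CQ.edge Q.0̂ Q.1̂ +
        (∑ (λ z → CS.edge (inj₁ x′) (inj₁ z) * b * CS.chainSum (inj₁ z) P⋆Q.1̂) elements₁ +
         ∑ (λ z → CS.edge (inj₁ x′) (inj₂ z) * b * CS.chainSum (inj₂ z) P⋆Q.1̂) elements₂)
        ≈⟨ +-congˡ (+-cong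
             (∑-restrict ≢1̂?
               (λ z z≢1̂ → trans
                 (CP.edge-*-cong (edge₁₁ x′ (z , irr z≢1̂)) λ x<z → ih z x<z z≢1̂)
                 (sym (*-assoc _ _ _)))
               -- The additional term at `P.1̂` vanishes because no chain leads from `P.1̂` to
               -- itself.
               (λ z ¬z≢1̂ → from-1̂ x z (decidable-stable (z P.≟ P.1̂) ¬z≢1̂)) P.elements)
             (∑-restrict ≢0̂?
               (λ z z≢0̂ → trans
                 (*-cong (*-congʳ (edge₁₂ x′ (z , irr z≢0̂))) (chainSum-inj₂ z z≢0̂))
                 (trans (*-congʳ (*-assoc _ _ _)) (*-assoc _ _ _)))
               -- The additional term at `Q.0̂` vanishes because its edge would be a step from
               -- `Q.0̂` to itself.
               (λ z ¬z≢0̂ → to-0̂ e z (decidable-stable (z Q.≟ Q.0̂) ¬z≢0̂)) Q.elements)) ⟩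
      e * CQ.edge Q.0̂ Q.1̂ +
        (∑ (λ z → CP.edge x z * b * CP.chainSum z P.1̂ * CQ.chainSum Q.0̂ Q.1̂) P.elements +
         ∑ (λ z → e * (CQ.edge Q.0̂ z * b * CQ.chainSum z Q.1̂)) Q.elements)
        ≈⟨ +-congˡ (+-cong (*-distribʳ-∑ _ _ P.elements) (*-distribˡ-∑ e _ Q.elements)) ⟨
      e * CQ.edge Q.0̂ Q.1̂ + (p * CQ.chainSum Q.0̂ Q.1̂ + e * q)
        ≈⟨ trans (+-congˡ (+-comm _ _)) (sym (+-assoc _ _ _)) ⟩
      e * CQ.edge Q.0̂ Q.1̂ + e * q + p * CQ.chainSum Q.0̂ Q.1̂
        ≈⟨ +-congʳ (trans (sym (distribˡ e _ _)) (*-congˡ (sym (CQ.chainSum-unfold Q.0̂ Q.1̂)))) ⟩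
      e * CQ.chainSum Q.0̂ Q.1̂ + p * CQ.chainSum Q.0̂ Q.1̂
        ≈⟨ distribʳ _ e p ⟨
      (e + p) * CQ.chainSum Q.0̂ Q.1̂
        ≈⟨ *-congʳ (CP.chainSum-unfold x P.1̂) ⟨
      CP.chainSum x P.1̂ * CQ.chainSum Q.0̂ Q.1̂ ∎
      where
      from-1̂ : ∀ x z {v} → z ≡ P.1̂ → CP.edge x z * b * CP.chainSum z P.1̂ * v ≈ 0#
      from-1̂ x z ≡.refl = trans
        (*-congʳ (trans (*-congˡ (CP.chainSum-empty {P.1̂} ℕ.≤-refl)) (zeroʳ _))) (zeroˡ _)

      to-0̂ : ∀ e z {v} → z ≡ Q.0̂ → e * (CQ.edge Q.0̂ z * b * v) ≈ 0#
      to-0̂ e z ≡.refl = trans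
        (*-congˡ (trans (*-congʳ (trans (*-congʳ (CQ.edge-≮ λ (_ , 0̂≢0̂) → 0̂≢0̂ ≡.refl)) (zeroˡ b))) (zeroˡ _)))
        (zeroʳ e)

-- The ab-index as a chain sum, and its step weights in the Stanley product.

module ABIndex {c ℓ} (K : CommutativeRing c ℓ) where

  open QuasiGraded K
  open FreeAlgebra K
  private module K = CommutativeRing K
  open Semiring polynomialSemiring using (setoid)
  open SumOver polynomialSemiring
  open Exp polynomialSemiring using (^-homo-*)

  module _ {p r} (P : QuasiGradedPoset p r) where
    open QuasiGradedPoset P

    step : ∀ x y → .(x < y) → Polynomial
    step x y x<y = ζ x y (proj₁ x<y) · (a + - b) ^ (ρ[ x , y ] ∸ 1)

  module _ {p r} (P : BoundedQuasiGradedPoset p r) where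
    open BoundedQuasiGradedPoset P
    open ChainSum K quasiGradedPoset polynomialSemiring b (step quasiGradedPoset) using (weight; chainSum)

    -- The `ab`-index gathers the values of `ζ` in front of a chain, while `weight` leaves each at
    -- its own step. Scalars move freely through products, so nothing changes.
    weight≈ : ∀ {x y} (γ : Chain x y) → ζ-product γ · chainPolynomial γ ≈ weight γ
    weight≈ [ _ ] = λ _ → K.refl
    weight≈ (_∷_ {x} {z} x<z γ) = begin
      (ζ x z (proj₁ x<z) K.* ζ-product γ) · (d * b * chainPolynomial γ)
        ≈⟨ ·-*-interchange (ζ x z (proj₁ x<z)) (ζ-product γ) (d * b) (chainPolynomial γ) ⟩
      (ζ x z (proj₁ x<z) · (d * b)) * (ζ-product γ · chainPolynomial γ)
        ≈⟨ *-cong {ζ x z (proj₁ x<z) · (d * b)} {(ζ x z (proj₁ x<z) · d) * b}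
                    {ζ-product γ · chainPolynomial γ} {weight γ}
             (λ w → K.sym (·-*-assoc (ζ x z (proj₁ x<z)) d b w)) (weight≈ γ) ⟩
      (ζ x z (proj₁ x<z) · d) * b * weight γ ∎
      where
      open SetoidReasoning setoid
      d = (a + - b) ^ (ρ[ x , z ] ∸ 1)

    Ψ≈chainSum : Ψ P ≈ chainSum 0̂ 1̂
    -- `Ψ P` unfolds to a `∑` over the same list of chains, so a termwise comparison suffices.
    Ψ≈chainSum = ∑-cong weight≈ (chains 0̂ 1̂)

  module _ {p₁ r₁ p₂ r₂} (P : BoundedQuasiGradedPoset p₁ r₁) (Q : BoundedQuasiGradedPoset p₂ r₂) where
    private
      module P = BoundedQuasiGradedPoset P
      module Q = BoundedQuasiGradedPoset Q
      module P⋆Q = BoundedQuasiGradedPoset (P ⋆ Q)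
      module S = StanleyProduct P Q

    -- This is where the shift of the grading on `Q` by one less than the rank of `P` matters: the
    -- exponents add up exactly.
    ρ₁₂ : ∀ x y → P⋆Q.ρ[ inj₁ x , inj₂ y ] ∸ 1 ≡
          (P.ρ[ value x , P.1̂ ] ∸ 1) ℕ.+ (Q.ρ[ Q.0̂ , value y ] ∸ 1)
    ρ₁₂ x y rewrite S.ρ[0̂,1̂] | Q.ρ-0̂ with Q.ρ (value y) | S.0<ρ₂ y
    -- With `suc q` for the rank of `y`, the `∸ 1` in the grading cancels. Both remaining
    -- subtractions are exact because `value x` has smaller rank than `P.1̂`.
    ... | suc q | _ = begin
      q ℕ.+ P.ρ P.1̂ ∸ P.ρ (value x) ∸ 1     ≡⟨ ≡.cong (_∸ 1) (ℕ.+-∸-assoc q (ℕ.<⇒≤ (S.ρ₁<ρ1̂ x))) ⟩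
      q ℕ.+ P.ρ[ value x , P.1̂ ] ∸ 1        ≡⟨ ℕ.+-∸-assoc q (ℕ.m<n⇒0<n∸m (S.ρ₁<ρ1̂ x)) ⟩
      q ℕ.+ (P.ρ[ value x , P.1̂ ] ∸ 1)      ≡⟨ ℕ.+-comm q _ ⟩
      (P.ρ[ value x , P.1̂ ] ∸ 1) ℕ.+ q      ∎
      where open ≡.≡-Reasoning

    -- The two ranks carry the same shift, which cancels. Since `0̂ < 1̂` in `P`, its rank is some
    -- `suc d`, so the `∸ 1` is not truncated and the shift is `d`.
    ρ₂₂ : ∀ x y → P⋆Q.ρ[ inj₂ x , inj₂ y ] ≡ Q.ρ[ value x , value y ]
    ρ₂₂ x y with P.ρ[ P.0̂ , P.1̂ ] | ℕ.m<n⇒0<n∸m (P.ρ-strictMono P.0̂<1̂)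
    ... | suc d | _
      rewrite ℕ.+-suc (Q.ρ (value x)) d | ℕ.+-suc (Q.ρ (value y)) d
            | ℕ.+-comm (Q.ρ (value x)) d | ℕ.+-comm (Q.ρ (value y)) d
            = ℕ.[m+n]∸[m+o]≡n∸o d (Q.ρ (value y)) (Q.ρ (value x))

    step₁₂ : ∀ x y .(x<1̂ : value x P.< P.1̂) .(0̂<y : Q.0̂ Q.< value y)
             .(x<y : inj₁ x P⋆Q.< inj₂ y) →
             step P⋆Q.quasiGradedPoset (inj₁ x) (inj₂ y) x<y ≈
             step P.quasiGradedPoset (value x) P.1̂ x<1̂ * step Q.quasiGradedPoset Q.0̂ (value y) 0̂<y
    step₁₂ x y x<1̂ 0̂<y x<y = begin
      (k K.* l) · d ^ (P⋆Q.ρ[ inj₁ x , inj₂ y ] ∸ 1)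
        -- The scalar is already `k K.* l` by the definition of `ζ` on mixed pairs; only the
        -- exponent needs rewriting.
        ≡⟨ ≡.cong (λ n → (k K.* l) · d ^ n) (ρ₁₂ x y) ⟩
      (k K.* l) · d ^ (m ℕ.+ n)
        ≈⟨ ·-cong (k K.* l) (d ^ (m ℕ.+ n)) (d ^ m * d ^ n) (^-homo-* d m n) ⟩
      (k K.* l) · (d ^ m * d ^ n)
        ≈⟨ ·-*-interchange k l (d ^ m) (d ^ n) ⟩
      (k · d ^ m) * (l · d ^ n) ∎
      where
      open SetoidReasoning setoid
      d = a + - b
      k = P.ζ (value x) P.1̂ (proj₁ x<1̂)
      l = Q.ζ Q.0̂ (value y) (proj₁ 0̂<y)
      m = P.ρ[ value x , P.1̂ ] ∸ 1
      n = Q.ρ[ Q.0̂ , value y ] ∸ 1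

    step₂₂ : ∀ x y .(x<y : value x Q.< value y) .(x<y′ : inj₂ x P⋆Q.< inj₂ y) →
             step P⋆Q.quasiGradedPoset (inj₂ x) (inj₂ y) x<y′ ≈
             step Q.quasiGradedPoset (value x) (value y) x<y
    step₂₂ x y x<y x<y′ w = K.reflexive (≡.cong
      (λ n → coefficient (Q.ζ (value x) (value y) (proj₁ x<y) · (a + - b) ^ (n ∸ 1)) w) (ρ₂₂ x y))

    Ψ-⋆ : Ψ (P ⋆ Q) ≈ Ψ P * Ψ Q
    Ψ-⋆ = begin
      Ψ (P ⋆ Q)
        ≈⟨ Ψ≈chainSum (P ⋆ Q) ⟩
      CS.chainSum P⋆Q.0̂ P⋆Q.1̂
        ≈⟨ chainSum-inj₁ P.0̂ (proj₂ P.0̂<1̂) ⟩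
      CP.chainSum P.0̂ P.1̂ * CQ.chainSum Q.0̂ Q.1̂
        ≈⟨ *-cong {Ψ P} {CP.chainSum P.0̂ P.1̂} {Ψ Q} {CQ.chainSum Q.0̂ Q.1̂}
             (Ψ≈chainSum P) (Ψ≈chainSum Q) ⟨
      Ψ P * Ψ Q ∎
      where
      open SetoidReasoning setoid
      open StanleyChainSum K P Q polynomialSemiring
      open Multiplicative b
        (step P.quasiGradedPoset) (step Q.quasiGradedPoset) (step P⋆Q.quasiGradedPoset)
        -- On the part coming from `P`, both `ρ` and `ζ` are those of `P` by definition. The fifth
        -- argument is the word whose coefficient is compared.
        (λ _ _ _ _ _ → K.refl) step₁₂ step₂₂

lemma5p3 : ∀ {c ℓ p₁ r₁ p₂ r₂ : Level} (K : CommutativeRing c ℓ) →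
    let open QuasiGraded K in
    (P : BoundedQuasiGradedPoset p₁ r₁) (Q : BoundedQuasiGradedPoset p₂ r₂) →
    Ψ (P ⋆ Q) ≈ Ψ P * Ψ Q
lemma5p3 K P Q = ABIndex.Ψ-⋆ K P Q
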